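{- Let $F\colon\mathbf{C}\to\mathbf{C}$ be an endofunctor on a category $\mathbf{C}$. The category of $F$-coalgebras is isomorphic to the category of $(\mathbb{N},+,0)$-graded coalgebras for the $(\mathbb{N},+,0)$-graded monad $(F^n)_{n\in\mathbb{N}}$.
   Context: An $F$-coalgebra is an object $X$ with a morphism $X\to FX$; homomorphisms are the usual ones. A monad $M$ graded by a monoid $(T,\cdot,e)$ on $\mathbf{C}$ consists of endofunctors $M_t$ ($t\in T$), natural transformations $\mu^{s,t}\colon M_sM_t\to M_{s\cdot t}$ and $\eta\colon\mathrm{Id}\to M_e$ such that $\mu^{r,s\cdot t}\circ M_r\mu^{s,t}=\mu^{r\cdot s,t}\circ\mu^{r,s}M_t$ and $\mu^{t,e}\circ M_t\eta=\mathrm{id}=\mu^{e,t}\circ\eta M_t$. The graded monad $(F^n)_{n\in\mathbb{N}}$ has as components the $n$-fold composites $F^n$ and as multiplications and unit the identities $F^mF^n=F^{m+n}$ and $\mathrm{Id}=F^0$. A graded coalgebra of $M$ is an object $X$ with morphisms $\gamma_t\colon X\to M_tX$ ($t\in T$) such that $\gamma_e=\eta_X$ and $\gamma_{s\cdot t}=\mu^{s,t}_X\circ M_s\gamma_t\circ\gamma_s$. A homomorphism $h\colon(X,\gamma)\to(Y,\delta)$ is a morphism $h\colon X\to Y$ with $M_th\circ\gamma_t=\delta_t\circ h$ for all $t$. -}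

module Defs where

open import Level using (Level; _⊔_; suc)
open import Algebra.Core using (Op₂)
open import Algebra.Structures using (IsMonoid)
open import Data.Nat.Base as ℕ using (ℕ; _+_)
open import Data.Nat.Properties
  using (+-0-isMonoid; +-assoc; +-identityʳ)
open import Relation.Binary.Core using (Rel)
open import Relation.Binary.Structures using (IsEquivalence)
open import Relation.Binary.PropositionalEquality.Core
  using (_≡_; refl; cong; trans)
open import Axiom.UniquenessOfIdentityProofs.WithK using (uip)

-- Hom-sets are setoids; equality of morphisms is _≈_ throughout.
record Category (o ℓ e : Level) : Set (suc (o ⊔ ℓ ⊔ e)) where
  infix  4 _≈_ _⇒_
  infixr 9 _∘_
  field
    Obj : Set o
    _⇒_ : Rel Obj ℓ
    _≈_ : ∀ {A B} → Rel (A ⇒ B) e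
    id  : ∀ {A} → A ⇒ A
    _∘_ : ∀ {A B C} → B ⇒ C → A ⇒ B → A ⇒ C
    ≈-equiv   : ∀ {A B} → IsEquivalence (_≈_ {A} {B})
    ∘-cong    : ∀ {A B C} {f h : B ⇒ C} {g i : A ⇒ B} →
                f ≈ h → g ≈ i → f ∘ g ≈ h ∘ i
    assoc     : ∀ {A B C D} {f : A ⇒ B} {g : B ⇒ C} {h : C ⇒ D} →
                (h ∘ g) ∘ f ≈ h ∘ (g ∘ f)
    identityˡ : ∀ {A B} {f : A ⇒ B} → id ∘ f ≈ f
    identityʳ : ∀ {A B} {f : A ⇒ B} → f ∘ id ≈ f

  module ≈ {A} {B} = IsEquivalence (≈-equiv {A} {B})

  -- The identity morphism between two objects that are equal, but not
  -- necessarily by computation.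
  ≡⇒id : ∀ {A B} → A ≡ B → A ⇒ B
  ≡⇒id refl = id

  ≡⇒id-∘ : ∀ {A B C} (q : B ≡ C) (p : A ≡ B) (r : A ≡ C) →
           ≡⇒id q ∘ ≡⇒id p ≈ ≡⇒id r
  ≡⇒id-∘ refl refl r rewrite uip r refl = identityˡ

record Functor {o ℓ e o′ ℓ′ e′} (C : Category o ℓ e) (D : Category o′ ℓ′ e′)
       : Set (o ⊔ ℓ ⊔ e ⊔ o′ ⊔ ℓ′ ⊔ e′) where
  private
    module C = Category C
    module D = Category D
  field
    F₀       : C.Obj → D.Obj
    F₁       : ∀ {A B} → A C.⇒ B → F₀ A D.⇒ F₀ B
    identity : ∀ {A} → F₁ (C.id {A}) D.≈ D.id
    homomorphism : ∀ {X Y Z} {f : X C.⇒ Y} {g : Y C.⇒ Z} →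
                   F₁ (g C.∘ f) D.≈ F₁ g D.∘ F₁ f
    F-resp-≈ : ∀ {A B} {f g : A C.⇒ B} → f C.≈ g → F₁ f D.≈ F₁ g

  F₁-≡⇒id : ∀ {A B} (p : A ≡ B) → F₁ (C.≡⇒id p) D.≈ D.≡⇒id (cong F₀ p)
  F₁-≡⇒id refl = identity

idF : ∀ {o ℓ e} {C : Category o ℓ e} → Functor C C
idF {C = C} = record
  { F₀ = λ A → A
  ; F₁ = λ f → f
  ; identity = ≈.refl
  ; homomorphism = ≈.refl
  ; F-resp-≈ = λ p → p
  }
  where open Category C

infixr 9 _∘F_
_∘F_ : ∀ {o ℓ e o′ ℓ′ e′ o″ ℓ″ e″}
       {C : Category o ℓ e} {D : Category o′ ℓ′ e′} {E : Category o″ ℓ″ e″} →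
       Functor D E → Functor C D → Functor C E
_∘F_ {E = E} G F = record
  { F₀ = λ A → G.F₀ (F.F₀ A)
  ; F₁ = λ f → G.F₁ (F.F₁ f)
  ; identity = ≈.trans (G.F-resp-≈ F.identity) G.identity
  ; homomorphism = ≈.trans (G.F-resp-≈ F.homomorphism) G.homomorphism
  ; F-resp-≈ = λ p → G.F-resp-≈ (F.F-resp-≈ p)
  }
  where
  open Category E
  module F = Functor F
  module G = Functor G

record NaturalTransformation {o ℓ e o′ ℓ′ e′}
       {C : Category o ℓ e} {D : Category o′ ℓ′ e′} (F G : Functor C D)
       : Set (o ⊔ ℓ ⊔ e ⊔ o′ ⊔ ℓ′ ⊔ e′) where
  private
    module C = Category C
    module F = Functor F
    module G = Functor G
  open Category D
  field
    component : ∀ X → F.F₀ X ⇒ G.F₀ X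
    commute   : ∀ {X Y} (f : X C.⇒ Y) →
                component Y ∘ F.F₁ f ≈ G.F₁ f ∘ component X

-- An isomorphism of categories refers to equality of objects.  When objects
-- carry morphisms (and laws) as data, the propositional equality of Agda is
-- finer than the intended equality: morphisms are compared by _≈_, and
-- families of morphisms pointwise.  So the equality of objects is made
-- explicit, together with the identity morphisms `≋⇒id` between equal
-- objects; `≋⇒id-id` and `≋⇒id-∘` make these coherent and independent of the
-- proof of equality.
record StrictCategory (o ℓ e r : Level) : Set (suc (o ⊔ ℓ ⊔ e ⊔ r)) where
  infix 4 _≋_
  field
    category : Category o ℓ e
  open Category category public
  field
    _≋_     : Rel Obj r
    ≋-equiv : IsEquivalence _≋_
    ≋⇒id    : ∀ {A B} → A ≋ B → A ⇒ B
    ≋⇒id-id : ∀ {A} (p : A ≋ A) → ≋⇒id p ≈ id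
    ≋⇒id-∘  : ∀ {A B C} (q : B ≋ C) (p : A ≋ B) (r : A ≋ C) →
              ≋⇒id q ∘ ≋⇒id p ≈ ≋⇒id r

record StrictFunctor {o ℓ e r o′ ℓ′ e′ r′}
       (C : StrictCategory o ℓ e r) (D : StrictCategory o′ ℓ′ e′ r′)
       : Set (o ⊔ ℓ ⊔ e ⊔ r ⊔ o′ ⊔ ℓ′ ⊔ e′ ⊔ r′) where
  private
    module C = StrictCategory C
    module D = StrictCategory D
  field
    functor : Functor C.category D.category
  open Functor functor public
  field
    F₀-resp-≋ : ∀ {A B} → A C.≋ B → F₀ A D.≋ F₀ B
    F₁-≋⇒id   : ∀ {A B} (p : A C.≋ B) →
                F₁ (C.≋⇒id p) D.≈ D.≋⇒id (F₀-resp-≋ p)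

-- Equality of functors: equal on objects and, up to the resulting
-- identification of domains and codomains, on morphisms.
record FunctorEquality {o ℓ e o′ ℓ′ e′ r′}
       {C : Category o ℓ e} (D : StrictCategory o′ ℓ′ e′ r′)
       (G H : Functor C (StrictCategory.category D))
       : Set (o ⊔ ℓ ⊔ e′ ⊔ r′) where
  private
    module C = Category C
    module G = Functor G
    module H = Functor H
  open StrictCategory D
  field
    eq₀ : ∀ A → G.F₀ A ≋ H.F₀ A
    eq₁ : ∀ {A B} (f : A C.⇒ B) →
          ≋⇒id (eq₀ B) ∘ G.F₁ f ≈ H.F₁ f ∘ ≋⇒id (eq₀ A)

infix 4 _≅_
record _≅_ {o ℓ e r o′ ℓ′ e′ r′}
       (C : StrictCategory o ℓ e r) (D : StrictCategory o′ ℓ′ e′ r′)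
       : Set (o ⊔ ℓ ⊔ e ⊔ r ⊔ o′ ⊔ ℓ′ ⊔ e′ ⊔ r′) where
  field
    to   : StrictFunctor C D
    from : StrictFunctor D C
  private
    module to = StrictFunctor to
    module from = StrictFunctor from
  field
    from∘to : FunctorEquality C (from.functor ∘F to.functor) idF
    to∘from : FunctorEquality D (to.functor ∘F from.functor) idF

module _ {o ℓ e} {C : Category o ℓ e} (F : Functor C C) where
  open Category C
  open Functor F

  record Coalgebra : Set (o ⊔ ℓ) where
    constructor coalgebra
    field
      X : Obj
      α : X ⇒ F₀ X

  record CoalgebraHom (A B : Coalgebra) : Set (ℓ ⊔ e) where
    private
      module A = Coalgebra A
      module B = Coalgebra B
    field
      h       : A.X ⇒ B.X
      commute : F₁ h ∘ A.α ≈ B.α ∘ h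

  -- Same carrier, equal structure morphisms.
  data _≋-Coalg_ : Rel Coalgebra (o ⊔ ℓ ⊔ e) where
    same : ∀ {X} {α β : X ⇒ F₀ X} → α ≈ β →
           coalgebra X α ≋-Coalg coalgebra X β

  Coalg : StrictCategory (o ⊔ ℓ) (ℓ ⊔ e) e (o ⊔ ℓ ⊔ e)
  Coalg = record
    { category = record
      { Obj = Coalgebra
      ; _⇒_ = CoalgebraHom
      ; _≈_ = λ f g → CoalgebraHom.h f ≈ CoalgebraHom.h g
      ; id  = record
        { h = id
        ; commute = ≈.trans (∘-cong identity ≈.refl)
                            (≈.trans identityˡ (≈.sym identityʳ))
        }
      ; _∘_ = λ g f → record
        { h = CoalgebraHom.h g ∘ CoalgebraHom.h f
        ; commute =
            ≈.trans (∘-cong homomorphism ≈.refl)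
            (≈.trans assoc
            (≈.trans (∘-cong ≈.refl (CoalgebraHom.commute f))
            (≈.trans (≈.sym assoc)
            (≈.trans (∘-cong (CoalgebraHom.commute g) ≈.refl) assoc))))
        }
      ; ≈-equiv = record { refl = ≈.refl ; sym = ≈.sym ; trans = ≈.trans }
      ; ∘-cong = ∘-cong
      ; assoc = assoc
      ; identityˡ = identityˡ
      ; identityʳ = identityʳ
      }
    ; _≋_ = _≋-Coalg_
    ; ≋-equiv = record
      { refl  = same ≈.refl
      ; sym   = λ { (same p) → same (≈.sym p) }
      ; trans = λ { (same p) (same q) → same (≈.trans p q) }
      }
    ; ≋⇒id = λ { (same p) → record
      { h = id
      ; commute = ≈.trans (∘-cong identity ≈.refl)
                  (≈.trans identityˡ (≈.trans p (≈.sym identityʳ)))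
      } }
    ; ≋⇒id-id = λ { (same _) → ≈.refl }
    ; ≋⇒id-∘ = λ { (same _) (same _) (same _) → identityˡ }
    }

module _ {t} {T : Set t} {_·_ : Op₂ T} {e : T} where

  record GradedMonad (isMonoid : IsMonoid _≡_ _·_ e)
                     {o ℓ e′} (C : Category o ℓ e′)
                     : Set (t ⊔ o ⊔ ℓ ⊔ e′) where
    open Category C hiding (assoc; identityˡ; identityʳ)
    private module · = IsMonoid isMonoid
    field
      M : T → Functor C C
      μ : ∀ s t → NaturalTransformation (M s ∘F M t) (M (s · t))
      η : NaturalTransformation idF (M e)

    M₀ : T → Obj → Obj
    M₀ t = Functor.F₀ (M t)

    M₁ : ∀ t {X Y} → X ⇒ Y → M₀ t X ⇒ M₀ t Y
    M₁ t = Functor.F₁ (M t)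

    μ[_,_] : ∀ s t X → M₀ s (M₀ t X) ⇒ M₀ (s · t) X
    μ[ s , t ] = NaturalTransformation.component (μ s t)

    η[_] : ∀ X → X ⇒ M₀ e X
    η[_] = NaturalTransformation.component η

    -- The identity M s X → M t X for equal grades s and t.  It is needed
    -- because the two sides of each law have codomains with equal, but
    -- syntactically different, grades.
    regrade : ∀ {s t} → s ≡ t → ∀ X → M₀ s X ⇒ M₀ t X
    regrade p X = ≡⇒id (cong (λ u → M₀ u X) p)

    field
      assoc : ∀ r s t X →
        μ[ r , s · t ] X ∘ M₁ r (μ[ s , t ] X)
          ≈ regrade (·.assoc r s t) X ∘ μ[ r · s , t ] X ∘ μ[ r , s ] (M₀ t X)
      identityʳ : ∀ t X →
        regrade (·.identityʳ t) X ∘ μ[ t , e ] X ∘ M₁ t η[ X ] ≈ id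
      identityˡ : ∀ t X →
        regrade (·.identityˡ t) X ∘ μ[ e , t ] X ∘ η[ M₀ t X ] ≈ id

module _ {t} {T : Set t} {_·_ : Op₂ T} {e : T} {isMonoid : IsMonoid _≡_ _·_ e}
         {o ℓ e′} {C : Category o ℓ e′} (𝕄 : GradedMonad isMonoid C) where
  open Category C
  open GradedMonad 𝕄 using (M; M₀; M₁; μ[_,_]; η[_])

  record IsGradedCoalgebra (X : Obj) (γ : ∀ t → X ⇒ M₀ t X) : Set (t ⊔ e′) where
    field
      unit : γ e ≈ η[ X ]
      mult : ∀ s t → γ (s · t) ≈ μ[ s , t ] X ∘ M₁ s (γ t) ∘ γ s

  record GradedCoalgebra : Set (t ⊔ o ⊔ ℓ ⊔ e′) where
    constructor gradedCoalgebra
    field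
      X : Obj
      γ : ∀ t → X ⇒ M₀ t X
      isGradedCoalgebra : IsGradedCoalgebra X γ

  record GradedCoalgebraHom (A B : GradedCoalgebra) : Set (t ⊔ ℓ ⊔ e′) where
    private
      module A = GradedCoalgebra A
      module B = GradedCoalgebra B
    field
      h       : A.X ⇒ B.X
      commute : ∀ t → M₁ t h ∘ A.γ t ≈ B.γ t ∘ h

  -- Same carrier, equal structure morphisms in every grade; the proofs of the
  -- laws are not compared.
  data _≋-GCoalg_ : Rel GradedCoalgebra (t ⊔ o ⊔ ℓ ⊔ e′) where
    same : ∀ {X} {γ δ : ∀ t → X ⇒ M₀ t X} {p q} → (∀ t → γ t ≈ δ t) →
           gradedCoalgebra X γ p ≋-GCoalg gradedCoalgebra X δ q

  GradedCoalg : StrictCategory (t ⊔ o ⊔ ℓ ⊔ e′) (t ⊔ ℓ ⊔ e′) e′ (t ⊔ o ⊔ ℓ ⊔ e′)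
  GradedCoalg = record
    { category = record
      { Obj = GradedCoalgebra
      ; _⇒_ = GradedCoalgebraHom
      ; _≈_ = λ f g → GradedCoalgebraHom.h f ≈ GradedCoalgebraHom.h g
      ; id  = record
        { h = id
        ; commute = λ t → ≈.trans (∘-cong (Functor.identity (M t)) ≈.refl)
                                  (≈.trans identityˡ (≈.sym identityʳ))
        }
      ; _∘_ = λ g f → record
        { h = GradedCoalgebraHom.h g ∘ GradedCoalgebraHom.h f
        ; commute = λ t →
            ≈.trans (∘-cong (Functor.homomorphism (M t)) ≈.refl)
            (≈.trans assoc
            (≈.trans (∘-cong ≈.refl (GradedCoalgebraHom.commute f t))
            (≈.trans (≈.sym assoc)
            (≈.trans (∘-cong (GradedCoalgebraHom.commute g t) ≈.refl) assoc))))
        }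
      ; ≈-equiv = record { refl = ≈.refl ; sym = ≈.sym ; trans = ≈.trans }
      ; ∘-cong = ∘-cong
      ; assoc = assoc
      ; identityˡ = identityˡ
      ; identityʳ = identityʳ
      }
    ; _≋_ = _≋-GCoalg_
    ; ≋-equiv = record
      { refl  = same (λ _ → ≈.refl)
      ; sym   = λ { (same p) → same (λ t → ≈.sym (p t)) }
      ; trans = λ { (same p) (same q) → same (λ t → ≈.trans (p t) (q t)) }
      }
    ; ≋⇒id = λ { (same p) → record
      { h = id
      ; commute = λ t → ≈.trans (∘-cong (Functor.identity (M t)) ≈.refl)
                        (≈.trans identityˡ (≈.trans (p t) (≈.sym identityʳ)))
      } }
    ; ≋⇒id-id = λ { (same _) → ≈.refl }
    ; ≋⇒id-∘ = λ { (same _) (same _) (same _) → identityˡ }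
    }

infixr 10 _^_
_^_ : ∀ {o ℓ e} {C : Category o ℓ e} → Functor C C → ℕ → Functor C C
F ^ ℕ.zero  = idF
F ^ ℕ.suc n = F ∘F (F ^ n)

module _ {o ℓ e} {C : Category o ℓ e} (F : Functor C C) where
  open Category C
  open Functor

  ^-+ : ∀ m n X → F₀ (F ^ m) (F₀ (F ^ n) X) ≡ F₀ (F ^ (m + n)) X
  ^-+ ℕ.zero    n X = refl
  ^-+ (ℕ.suc m) n X = cong (F₀ F) (^-+ m n X)

  ^-+-natural : ∀ m n {X Y} (f : X ⇒ Y) →
    ≡⇒id (^-+ m n Y) ∘ F₁ (F ^ m) (F₁ (F ^ n) f)
      ≈ F₁ (F ^ (m + n)) f ∘ ≡⇒id (^-+ m n X)
  ^-+-natural ℕ.zero    n f = ≈.trans identityˡ (≈.sym identityʳ)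
  ^-+-natural (ℕ.suc m) n {X} {Y} f =
    ≈.trans (∘-cong (≈.sym (F₁-≡⇒id F (^-+ m n Y))) ≈.refl)
    (≈.trans (≈.sym (homomorphism F))
    (≈.trans (F-resp-≈ F (^-+-natural m n f))
    (≈.trans (homomorphism F)
             (∘-cong ≈.refl (F₁-≡⇒id F (^-+ m n X))))))

  -- The multiplications are identities in the form ≡⇒id because F^m F^n X and
  -- F^(m+n) X, for variable m, are only propositionally equal.
  powers : GradedMonad +-0-isMonoid C
  powers = record
    { M = F ^_
    ; μ = λ m n → record
      { component = λ X → ≡⇒id (^-+ m n X)
      ; commute   = ^-+-natural m n
      }
    ; η = record
      { component = λ X → id
      ; commute   = λ f → ≈.trans identityˡ (≈.sym identityʳ)
      }
    ; assoc = λ r s t X →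
        let p₁ = cong (F₀ (F ^ r)) (^-+ s t X)
            p₂ = ^-+ r (s + t) X
            q₁ = ^-+ r s (F₀ (F ^ t) X)
            q₂ = ^-+ (r + s) t X
            q₃ = cong (λ n → F₀ (F ^ n) X) (+-assoc r s t)
        in
        ≈.trans (∘-cong ≈.refl (F₁-≡⇒id (F ^ r) (^-+ s t X)))
        (≈.trans (≡⇒id-∘ p₂ p₁ (trans p₁ p₂))
        (≈.sym (≈.trans (∘-cong ≈.refl (≡⇒id-∘ q₂ q₁ (trans q₁ q₂)))
                        (≡⇒id-∘ q₃ (trans q₁ q₂) (trans p₁ p₂)))))
    ; identityʳ = λ t X →
        ≈.trans (∘-cong ≈.refl
                  (≈.trans (∘-cong ≈.refl (identity (F ^ t))) identityʳ))
                (≡⇒id-∘ (cong (λ n → F₀ (F ^ n) X) (+-identityʳ t))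
                        (^-+ t 0 X) refl)
    ; identityˡ = λ t X → ≈.trans identityˡ identityˡ
    }

{-# OPTIONS --safe #-}
-- The law for γ at 1 + n expresses γ (1 + n) through γ n and γ 1, so a graded
-- coalgebra of the powers of F is determined by γ 1; conversely the iterates
-- of α : X ⇒ F X form a graded coalgebra with α in grade 1.
module Submission where

open import Data.Nat.Base using (ℕ; zero; suc; _+_)
open import Relation.Binary.Bundles using (Setoid)
import Relation.Binary.Reasoning.Setoid as SetoidReasoning

open import Defs

module _ {o ℓ e} {C : Category o ℓ e} (F : Functor C C) where
  open Category C
  open Functor

  private
    homSetoid : Obj → Obj → Setoid ℓ e
    homSetoid A B = record { Carrier = A ⇒ B ; _≈_ = _≈_ ; isEquivalence = ≈-equiv }

    module HomReasoning {A B} = SetoidReasoning (homSetoid A B)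
  open HomReasoning

  -- Applying `α` first gives the codomain `F ^ suc n` by computation. Ending with `F ^ n` of `α`
  -- would land in `F ^ n` of `F X`, which needs a transport.
  iterate : ∀ {X} → X ⇒ F₀ F X → ∀ n → X ⇒ F₀ (F ^ n) X
  iterate α zero    = id
  iterate α (suc n) = F₁ F (iterate α n) ∘ α

  iterate-cong : ∀ {X} {α β : X ⇒ F₀ F X} → α ≈ β → ∀ n → iterate α n ≈ iterate β n
  iterate-cong p zero    = ≈.refl
  iterate-cong p (suc n) = ∘-cong (F-resp-≈ F (iterate-cong p n)) p

  -- By induction on `m`: apply `F` to the equation for `m` and precompose with `α`. This supplies
  -- the law `mult`.
  iterate-+ : ∀ {X} (α : X ⇒ F₀ F X) m n →
    iterate α (m + n) ≈ ≡⇒id (^-+ F m n X) ∘ F₁ (F ^ m) (iterate α n) ∘ iterate α m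
  iterate-+ α zero    n = ≈.sym (≈.trans identityˡ identityʳ)
  iterate-+ {X} α (suc m) n = begin
    F₁ F (iterate α (m + n)) ∘ α
      ≈⟨ ∘-cong (F-resp-≈ F (iterate-+ α m n)) ≈.refl ⟩
    F₁ F (≡⇒id (^-+ F m n X) ∘ F₁ (F ^ m) (iterate α n) ∘ iterate α m) ∘ α
      -- `F` preserves identities between equal objects, and `^-+` at `suc m` is by definition
      -- `cong (F₀ F)` of `^-+` at `m`.
      ≈⟨ ∘-cong (≈.trans (homomorphism F) (∘-cong (F₁-≡⇒id F (^-+ F m n X)) (homomorphism F))) ≈.refl ⟩
    (≡⇒id (^-+ F (suc m) n X) ∘ F₁ (F ^ suc m) (iterate α n) ∘ F₁ F (iterate α m)) ∘ α
      ≈⟨ ≈.trans assoc (∘-cong ≈.refl assoc) ⟩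
    ≡⇒id (^-+ F (suc m) n X) ∘ F₁ (F ^ suc m) (iterate α n) ∘ iterate α (suc m)
      ∎

  -- By induction on `n`: the image under `F` of the square at `n` is pasted to the square for `α`
  -- and `β`.
  iterate-commute : ∀ {X Y} {α : X ⇒ F₀ F X} {β : Y ⇒ F₀ F Y} {h : X ⇒ Y} →
    F₁ F h ∘ α ≈ β ∘ h → ∀ n → F₁ (F ^ n) h ∘ iterate α n ≈ iterate β n ∘ h
  iterate-commute p zero = ≈.trans identityʳ (≈.sym identityˡ)
  iterate-commute {α = α} {β} {h} p (suc n) = begin
    F₁ F (F₁ (F ^ n) h) ∘ F₁ F (iterate α n) ∘ α    ≈⟨ assoc ⟨
    (F₁ F (F₁ (F ^ n) h) ∘ F₁ F (iterate α n)) ∘ α  ≈⟨ ∘-cong (homomorphism F) ≈.refl ⟨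
    F₁ F (F₁ (F ^ n) h ∘ iterate α n) ∘ α           ≈⟨ ∘-cong (F-resp-≈ F (iterate-commute p n)) ≈.refl ⟩
    F₁ F (iterate β n ∘ h) ∘ α                      ≈⟨ ∘-cong (homomorphism F) ≈.refl ⟩
    (F₁ F (iterate β n) ∘ F₁ F h) ∘ α               ≈⟨ assoc ⟩
    F₁ F (iterate β n) ∘ F₁ F h ∘ α                 ≈⟨ ∘-cong ≈.refl p ⟩
    F₁ F (iterate β n) ∘ β ∘ h                      ≈⟨ assoc ⟨
    iterate β (suc n) ∘ h                           ∎

  iterate-unique : ∀ {X} {γ : ∀ n → X ⇒ F₀ (F ^ n) X} →
    IsGradedCoalgebra (powers F) X γ → ∀ n → iterate (γ 1) n ≈ γ n
  iterate-unique isGC zero = ≈.sym (IsGradedCoalgebra.unit isGC)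
  iterate-unique {γ = γ} isGC (suc n) = begin
    F₁ F (iterate (γ 1) n) ∘ γ 1  ≈⟨ ∘-cong (F-resp-≈ F (iterate-unique isGC n)) ≈.refl ⟩
    -- The multiplication at grades 1 and `n` computes to `id`, since `^-+ F 1 n X` reduces to
    -- `refl`.
    F₁ F (γ n) ∘ γ 1              ≈⟨ identityˡ ⟨
    id ∘ F₁ F (γ n) ∘ γ 1         ≈⟨ IsGradedCoalgebra.mult isGC 1 n ⟨
    γ (suc n)                     ∎

  Coalg⇒GradedCoalg : StrictFunctor (Coalg F) (GradedCoalg (powers F))
  Coalg⇒GradedCoalg = record
    { functor = record
      { F₀ = λ (coalgebra X α) → gradedCoalgebra X (iterate α) (record
        { unit = ≈.refl
        ; mult = iterate-+ α
        })
      ; F₁ = λ f → record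
        { h       = CoalgebraHom.h f
        ; commute = iterate-commute (CoalgebraHom.commute f)
        }
      ; identity     = ≈.refl
      ; homomorphism = ≈.refl
      ; F-resp-≈     = λ p → p
      }
    ; F₀-resp-≋ = λ { (same p) → same (iterate-cong p) }
    ; F₁-≋⇒id   = λ { (same p) → ≈.refl }
    }

  GradedCoalg⇒Coalg : StrictFunctor (GradedCoalg (powers F)) (Coalg F)
  GradedCoalg⇒Coalg = record
    { functor = record
      { F₀ = λ (gradedCoalgebra X γ _) → coalgebra X (γ 1)
      ; F₁ = λ f → record
        { h       = GradedCoalgebraHom.h f
        ; commute = GradedCoalgebraHom.commute f 1
        }
      ; identity     = ≈.refl
      ; homomorphism = ≈.refl
      ; F-resp-≈     = λ p → p
      }
    ; F₀-resp-≋ = λ { (same p) → same (p 1) }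
    ; F₁-≋⇒id   = λ { (same p) → ≈.refl }
    }

proposition2p9 : ∀ {o ℓ e} {C : Category o ℓ e} (F : Functor C C) → Coalg F ≅ GradedCoalg (powers F)
proposition2p9 {C = C} F = record
  { to      = Coalg⇒GradedCoalg F
  ; from    = GradedCoalg⇒Coalg F
  ; from∘to = record
    -- `iterate α 1` is `F₁ F id ∘ α`, which equals `α` only up to `≈`.
    { eq₀ = λ A → same (≈.trans (∘-cong (Functor.identity F) ≈.refl) identityˡ)
    ; eq₁ = λ f → ≈.trans identityˡ (≈.sym identityʳ)
    }
  ; to∘from = record
    { eq₀ = λ A → same (iterate-unique F (GradedCoalgebra.isGradedCoalgebra A))
    -- The round trip keeps the underlying morphism, and `≋⇒id` has underlying morphism `id`.
    ; eq₁ = λ f → ≈.trans identityˡ (≈.sym identityʳ)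
    }
  }
  where open Category C
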